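{- Let $D<0$ be an integer with $D\equiv0\pmod4$. There exist integers $a,b$ with $$D=b^2-4a^2,\qquad |b|\leqslant a,\qquad \gcd(a,b)=1$$ if and only if $D/4$ factors as $D/4=-FG$ with $F,G$ positive integers such that $\frac{F+G}{2}$ is an integer, $$\frac13\leqslant\frac FG\leqslant3\quad\text{and}\quad \gcd\left(\tfrac{F+G}{2},\,2G\right)=1.$$ -}

module Defs where

{-# OPTIONS --safe #-}
-- Since 4 ∣ D, the integer b is even, say b = 2β.  The correspondence is
-- F = a − β, G = a + β, so that a² − β² = FG and (F + G)/2 = a.
-- The two bounds on F/G are those on ±b, because 3F − G = 2(a − b) and
-- 3G − F = 2(a + b); the gcds agree because 2G = b + 2a.
module Submission where

open import Data.Integer.Base using (ℤ; +_; -_; _-_; _*_; _^_; _≤_; _<_; ∣_∣)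
open import Data.Integer.DivMod using (_/_; _%_)
open import Data.Integer.GCD using (gcd)
open import Data.Nat.Base as ℕ using (ℕ)
open import Data.Nat.DivMod as ℕ using ()
open import Data.Nat.Divisibility as ℕ using ()
open import Data.Nat.GCD as ℕ using ()
open import Data.Product.Base using (∃; ∃₂; _×_)
open import Data.Rational.Base as ℚ using ()
open import Function.Bundles using (_⇔_)
open import Relation.Binary.PropositionalEquality.Core using (_≡_)
open import Defs

open import Data.Integer.Base using (_+_; -[1+_]; -≤+; NonNegative)
open import Data.Integer.DivMod using (a≡a%n+[a/n]*n)
open import Data.Integer.Divisibility.Signed using (_∣_; divides; ∣ᵤ⇒∣; ∣⇒∣ᵤ; ∣m∣n⇒∣m+n; ∣n⇒∣m*n)
open import Data.Integer.GCD using (gcd[i,j]∣i; gcd[i,j]∣j; gcd-greatest)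
open import Data.Integer.Properties as ℤ using ()
open import Data.Integer.Tactic.RingSolver using (solve-∀)
open import Data.Nat.Primality using (euclidsLemma; prime[2])
open import Data.Nat.Properties as ℕ using ()
open import Data.Product.Base using (_,_; proj₁; proj₂)
open import Data.Rational.Properties as ℚ using ()
open import Data.Rational.Unnormalised.Base as ℚᵘ using (mkℚᵘ)
open import Data.Rational.Unnormalised.Properties as ℚᵘ using ()
open import Data.Sum.Base using (inj₁; inj₂; reduce)
open import Function.Base using (_∘_)
open import Function.Bundles using (mk⇔; module Equivalence)
open import Relation.Binary.PropositionalEquality.Core using (refl; sym; trans; cong; cong₂; subst; subst₂)
open import Relation.Nullary.Negation using (¬_)

open Equivalence using (to; from)

-- `ℚ._/_` reduces to lowest terms, which hides the given numerators and denominators. Unnormalised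
-- rationals keep them, their order is cross multiplication by definition, and `toℚᵘ-fromℚᵘ` shows
-- that reducing preserves the value.
/-≤-/⇔*≤* : ∀ i j m n .{{_ : ℕ.NonZero m}} .{{_ : ℕ.NonZero n}} →
            (i ℚ./ m) ℚ.≤ (j ℚ./ n) ⇔ i * + n ≤ j * + m
/-≤-/⇔*≤* i j (ℕ.suc m) (ℕ.suc n) = mk⇔
  (ℚᵘ.drop-*≤* ∘ ℚᵘ.≤-respˡ-≃ p≃ ∘ ℚᵘ.≤-respʳ-≃ q≃ ∘ ℚ.toℚᵘ-mono-≤)
  (ℚ.toℚᵘ-cancel-≤ ∘ ℚᵘ.≤-respˡ-≃ (ℚᵘ.≃-sym p≃) ∘ ℚᵘ.≤-respʳ-≃ (ℚᵘ.≃-sym q≃) ∘ ℚᵘ.*≤*)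
  where
  p≃ = ℚ.toℚᵘ-fromℚᵘ (mkℚᵘ i m)
  q≃ = ℚ.toℚᵘ-fromℚᵘ (mkℚᵘ j n)

+∣i∣≤j⇔ : ∀ i j → + ∣ i ∣ ≤ j ⇔ (i ≤ j × - i ≤ j)
+∣i∣≤j⇔ i j = mk⇔
  (λ p → ℤ.≤-trans (i≤+∣i∣ i) p ,
         ℤ.≤-trans (subst (λ k → - i ≤ + k) (ℤ.∣-i∣≡∣i∣ i) (i≤+∣i∣ (- i))) p)
  back
  where
  i≤+∣i∣ : ∀ i → i ≤ + ∣ i ∣
  i≤+∣i∣ (+ _)    = ℤ.≤-refl
  i≤+∣i∣ -[1+ _ ] = -≤+

  back : i ≤ j × - i ≤ j → + ∣ i ∣ ≤ j
  back (i≤j , -i≤j) with ℤ.+∣i∣≡i⊎+∣i∣≡-i i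
  ... | inj₁ eq = subst (_≤ j) (sym eq) i≤j
  ... | inj₂ eq = subst (_≤ j) (sym eq) -i≤j

-- Doubling preserves and reflects the sign of a difference. Each comparison between `F`, `G` and
-- `a`, `b` below thereby reduces to one ring identity.
scaledDifference-≤ : ∀ {i j k l} → j - i ≡ + 2 * (l - k) → k ≤ l ⇔ i ≤ j
scaledDifference-≤ {i} {j} {k} {l} eq = mk⇔
  (λ k≤l → ℤ.0≤i-j⇒j≤i (subst (+ 0 ≤_) (sym eq)
             (ℤ.*-monoˡ-≤-nonNeg (+ 2) (ℤ.i≤j⇒0≤j-i k≤l))))
  (λ i≤j → ℤ.0≤i-j⇒j≤i (ℤ.*-cancelˡ-≤-pos (+ 0) (l - k) (+ 2)
             (subst (+ 0 ≤_) eq (ℤ.i≤j⇒0≤j-i i≤j))))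

-- A common divisor of `a` and `c` divides `c + k * a`, hence also `gcd a b`. One direction
-- suffices: the converse is the same lemma with `- k`.
gcd≡1-shift : ∀ a b c k → b ≡ c + k * a → gcd a b ≡ + 1 → gcd a c ≡ + 1
gcd≡1-shift a b c k b≡c+ka gcd≡1 = cong +_ (ℕ.∣1⇒≡1
  (subst (g ℕ.∣_) (ℤ.+-injective gcd≡1) (gcd-greatest {a} {b} {+ g} g∣a (∣⇒∣ᵤ g∣b))))
  where
  g = ∣ gcd a c ∣
  g∣a = gcd[i,j]∣i a c

  g∣b : + g ∣ b
  g∣b = subst (+ g ∣_) (sym b≡c+ka)
          (∣m∣n⇒∣m+n {m = c} (∣ᵤ⇒∣ (gcd[i,j]∣j a c)) (∣n⇒∣m*n k {a} (∣ᵤ⇒∣ g∣a)))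

2∣i*i⇒2∣i : ∀ {i} → + 2 ∣ i * i → + 2 ∣ i
2∣i*i⇒2∣i {i} 2∣i*i = ∣ᵤ⇒∣ (reduce (euclidsLemma ∣ i ∣ ∣ i ∣ prime[2]
  (subst (2 ℕ.∣_) (ℤ.abs-* i i) (∣⇒∣ᵤ 2∣i*i))))

-- Here `b * b` equals `4q + 4a²`, which is even, and 2 is prime.
b²-4a²≡4q⇒2∣b : ∀ a b q → b ^ 2 - + 4 * a ^ 2 ≡ q * + 4 → + 2 ∣ b
b²-4a²≡4q⇒2∣b a b q eq = 2∣i*i⇒2∣i (divides (q * + 2 + + 2 * (a * a))
  (trans (expand a b) (trans (cong (_+ + 4 * (a * a)) eq) (collect a q))))
  where
  -- i ^ 2 unfolds to i * (i * + 1), the form the ring solver can read.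
  expand : ∀ a b → b * b ≡ b * (b * + 1) - + 4 * (a * (a * + 1)) + + 4 * (a * a)
  expand = solve-∀

  collect : ∀ a q → q * + 4 + + 4 * (a * a) ≡ (q * + 2 + + 2 * (a * a)) * + 2
  collect = solve-∀

module _ (a β : ℤ) where

  differenceOfSquares : (β * + 2) ^ 2 - + 4 * a ^ 2 ≡ - ((a - β) * (a + β)) * + 4
  differenceOfSquares = lemma a β
    where
    lemma : ∀ a β → (β * + 2) * ((β * + 2) * + 1) - + 4 * (a * (a * + 1)) ≡
                    - ((a - β) * (a + β)) * + 4
    lemma = solve-∀

  -- The right side is `1/3 ≤ F/G` in the exact form that `/-≤-/⇔*≤*` produces, hence the factor
  -- `+ 1`; `-b≤a⇔` treats `F/G ≤ 3` likewise.
  b≤a⇔ : β * + 2 ≤ a ⇔ + 1 * (a + β) ≤ (a - β) * + 3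
  b≤a⇔ = scaledDifference-≤ (lemma a β)
    where
    lemma : ∀ a β → (a - β) * + 3 - + 1 * (a + β) ≡ + 2 * (a - β * + 2)
    lemma = solve-∀

  -b≤a⇔ : - (β * + 2) ≤ a ⇔ (a - β) * + 1 ≤ + 3 * (a + β)
  -b≤a⇔ = scaledDifference-≤ (lemma a β)
    where
    lemma : ∀ a β → + 3 * (a + β) - (a - β) * + 1 ≡ + 2 * (a - - (β * + 2))
    lemma = solve-∀

  -- Twice `a - β` is `2a - b`, and `b ≤ a ≤ 2a` since `a` is nonnegative.
  0≤F : .{{_ : NonNegative a}} → β * + 2 ≤ a → + 0 ≤ a - β
  0≤F b≤a = from (scaledDifference-≤ (lemma a β)) (ℤ.≤-trans b≤a (ℤ.i≤i+j a a))
    where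
    lemma : ∀ a β → a + a - β * + 2 ≡ + 2 * (a - β - + 0)
    lemma = solve-∀

  0≤G : .{{_ : NonNegative a}} → - (β * + 2) ≤ a → + 0 ≤ a + β
  0≤G -b≤a = from (scaledDifference-≤ (lemma a β)) (ℤ.≤-trans -b≤a (ℤ.i≤i+j a a))
    where
    lemma : ∀ a β → a + a - - (β * + 2) ≡ + 2 * (a + β - + 0)
    lemma = solve-∀

  F+G≡a*2 : (a - β) + (a + β) ≡ a * + 2
  F+G≡a*2 = lemma a β
    where
    lemma : ∀ a β → (a - β) + (a + β) ≡ a * + 2
    lemma = solve-∀

  2G≡b+2a : + 2 * (a + β) ≡ β * + 2 + + 2 * a
  2G≡b+2a = lemma a β
    where
    lemma : ∀ a β → + 2 * (a + β) ≡ β * + 2 + + 2 * a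
    lemma = solve-∀

  b≡2G-2a : β * + 2 ≡ + 2 * (a + β) + - (+ 2) * a
  b≡2G-2a = lemma a β
    where
    lemma : ∀ a β → β * + 2 ≡ + 2 * (a + β) + - (+ 2) * a
    lemma = solve-∀

proposition13 : (D : ℤ) → D < + 0 → D % + 4 ≡ 0 →
    (∃₂ λ (a b : ℤ) →
    D ≡ b ^ 2 - + 4 * a ^ 2
    × + ∣ b ∣ ≤ a
    × gcd a b ≡ + 1)
    ⇔
    (∃₂ λ (F G : ℕ) →
    0 ℕ.< F
    × ∃ λ (G>0 : 0 ℕ.< G) →
    let F/G = ℚ._/_ (+ F) G {{ ℕ.>-nonZero G>0 }} in
    D / + 4 ≡ - (+ F * + G)
    × 2 ℕ.∣ F ℕ.+ G
    × (+ 1 ℚ./ 3) ℚ.≤ F/G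
    × F/G ℚ.≤ (+ 3 ℚ./ 1)
    × ℕ.gcd ((F ℕ.+ G) ℕ./ 2) (2 ℕ.* G) ≡ 1)
proposition13 D D<0 D%4≡0 = mk⇔ forward backward
  where
  D≡D/4*4 : D ≡ D / + 4 * + 4
  D≡D/4*4 = trans (a≡a%n+[a/n]*n D (+ 4))
    (trans (cong (λ r → + r + D / + 4 * + 4) D%4≡0) (ℤ.+-identityˡ _))

  D≢0 : ¬ D ≡ + 0
  D≢0 D≡0 = ℤ.<-irrefl D≡0 D<0

  Representation = ∃₂ λ (a b : ℤ) →
    D ≡ b ^ 2 - + 4 * a ^ 2 × + ∣ b ∣ ≤ a × gcd a b ≡ + 1

  Factorisation = ∃₂ λ (F G : ℕ) → 0 ℕ.< F × ∃ λ (G>0 : 0 ℕ.< G) →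
    let F/G = ℚ._/_ (+ F) G {{ ℕ.>-nonZero G>0 }} in
    D / + 4 ≡ - (+ F * + G)
    × 2 ℕ.∣ F ℕ.+ G
    × (+ 1 ℚ./ 3) ℚ.≤ F/G
    × F/G ℚ.≤ (+ 3 ℚ./ 1)
    × ℕ.gcd ((F ℕ.+ G) ℕ./ 2) (2 ℕ.* G) ≡ 1

  -- `F` and `G` are variables tied to `n` and `β` by equations, not absolute values, so that the
  -- case of a zero factor can be matched with `refl`.
  factorise : ∀ n β F G → + F ≡ + n - β → + G ≡ + n + β →
    D ≡ (β * + 2) ^ 2 - + 4 * (+ n) ^ 2 →
    β * + 2 ≤ + n → - (β * + 2) ≤ + n → gcd (+ n) (β * + 2) ≡ + 1 → Factorisation
  factorise n β F G F≡ G≡ D≡ b≤a -b≤a gcd≡1 =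
    F , G , F>0 , G>0 ,
    D/4≡-FG ,
    2∣F+G ,
    from (/-≤-/⇔*≤* (+ 1) (+ F) 3 G)
      (subst₂ (λ f g → + 1 * g ≤ f * + 3) (sym F≡) (sym G≡) (to (b≤a⇔ (+ n) β) b≤a)) ,
    from (/-≤-/⇔*≤* (+ F) (+ 3) G 1)
      (subst₂ (λ f g → f * + 1 ≤ + 3 * g) (sym F≡) (sym G≡) (to (-b≤a⇔ (+ n) β) -b≤a)) ,
    -- The half `(F + G) / 2` is the quotient `n` stored in the divisibility proof.
    ℤ.+-injective (subst (λ m → gcd (+ m) (+ (2 ℕ.* G)) ≡ + 1) (sym (ℕ.n/m≡quotient 2∣F+G))
      (gcd≡1-shift (+ n) (β * + 2) (+ (2 ℕ.* G)) (- + 2) b≡ gcd≡1))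
    where
    D≡-FG*4 : D ≡ - (+ F * + G) * + 4
    D≡-FG*4 = trans D≡ (trans (differenceOfSquares (+ n) β)
      (cong₂ (λ f g → - (f * g) * + 4) (sym F≡) (sym G≡)))

    D/4≡-FG : D / + 4 ≡ - (+ F * + G)
    D/4≡-FG = ℤ.*-cancelʳ-≡ _ _ (+ 4) (trans (sym D≡D/4*4) D≡-FG*4)

    F>0 : 0 ℕ.< F
    -- A zero factor would give `D = 0`, against `D < 0`. For `F = 0` the product computes to 0; for
    -- `G = 0` it needs `*-zeroʳ`.
    F>0 = ℕ.n≢0⇒n>0 λ { refl → D≢0 D≡-FG*4 }

    G>0 : 0 ℕ.< G
    G>0 = ℕ.n≢0⇒n>0 λ { refl →
      D≢0 (trans D≡-FG*4 (cong (λ x → - x * + 4) (ℤ.*-zeroʳ (+ F)))) }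

    instance
      G≢0 : ℕ.NonZero G
      G≢0 = ℕ.>-nonZero G>0

    F+G≡n*2 : F ℕ.+ G ≡ n ℕ.* 2
    F+G≡n*2 = ℤ.+-injective (trans (cong₂ _+_ F≡ G≡)
      (trans (F+G≡a*2 (+ n) β) (sym (ℤ.pos-* n 2))))

    2∣F+G : 2 ℕ.∣ F ℕ.+ G
    2∣F+G = ℕ.divides n F+G≡n*2

    b≡ : β * + 2 ≡ + (2 ℕ.* G) + - + 2 * + n
    b≡ = trans (b≡2G-2a (+ n) β)
      (cong (_+ - + 2 * + n) (trans (cong (+ 2 *_) (sym G≡)) (sym (ℤ.pos-* 2 G))))

  forward : Representation → Factorisation
  forward (a , b , D≡ , ∣b∣≤a , gcd≡1)
    with b²-4a²≡4q⇒2∣b a b (D / + 4) (trans (sym D≡) D≡D/4*4)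
  -- No absolute value is bounded by a negative number, so `a` is a natural number `n`.
  forward (-[1+ _ ] , _ , _ , () , _) | _
  forward (a@(+ n) , _ , D≡ , ∣b∣≤a , gcd≡1) | divides β refl =
    factorise n β ∣ a - β ∣ ∣ a + β ∣
      (ℤ.0≤i⇒+∣i∣≡i (0≤F a β b≤a)) (ℤ.0≤i⇒+∣i∣≡i (0≤G a β -b≤a)) D≡ b≤a -b≤a gcd≡1
    where
    b≤a = proj₁ (to (+∣i∣≤j⇔ _ _) ∣b∣≤a)
    -b≤a = proj₂ (to (+∣i∣≤j⇔ _ _) ∣b∣≤a)

  backward : Factorisation → Representation
  backward (F , G , F>0 , G>0 , D/4≡-FG , 2∣F+G@(ℕ.divides n F+G≡n*2) , 1/3≤F/G , F/G≤3 , gcd≡1) =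
    + n , β * + 2 ,
    trans D≡D/4*4 (trans (cong (_* + 4) D/4≡-FG) (trans
      (cong₂ (λ f g → - (f * g) * + 4) F≡ G≡) (sym (differenceOfSquares (+ n) β)))) ,
    from (+∣i∣≤j⇔ _ _)
      ( from (b≤a⇔ (+ n) β) (subst₂ (λ f g → + 1 * g ≤ f * + 3) F≡ G≡
          (to (/-≤-/⇔*≤* (+ 1) (+ F) 3 G) 1/3≤F/G))
      , from (-b≤a⇔ (+ n) β) (subst₂ (λ f g → f * + 1 ≤ + 3 * g) F≡ G≡
          (to (/-≤-/⇔*≤* (+ F) (+ 3) G 1) F/G≤3))) ,
    gcd≡1-shift (+ n) (+ (2 ℕ.* G)) (β * + 2) (+ 2) 2G≡
      (cong +_ (subst (λ m → ℕ.gcd m (2 ℕ.* G) ≡ 1) (ℕ.n/m≡quotient 2∣F+G) gcd≡1))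
    where
    instance
      G≢0 : ℕ.NonZero G
      G≢0 = ℕ.>-nonZero G>0

    -- Since `n` is `(F + G) / 2`, this is `(G - F) / 2`, and the resulting `b` is `G - F`.
    β = + G - + n

    G≡ : + G ≡ + n + β
    G≡ = lemma (+ n) (+ G)
      where
      lemma : ∀ a g → g ≡ a + (g - a)
      lemma = solve-∀

    F≡ : + F ≡ + n - β
    F≡ = trans (lemma (+ F) (+ G)) (trans
      (cong (_- + G) (trans (cong +_ F+G≡n*2) (ℤ.pos-* n 2))) (lemma′ (+ n) (+ G)))
      where
      lemma : ∀ f g → f ≡ f + g - g
      lemma = solve-∀

      lemma′ : ∀ a g → a * + 2 - g ≡ a - (g - a)
      lemma′ = solve-∀

    2G≡ : + (2 ℕ.* G) ≡ β * + 2 + + 2 * + n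
    2G≡ = trans (ℤ.pos-* 2 G) (trans (cong (+ 2 *_) G≡) (2G≡b+2a (+ n) β))
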